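{- For all impartial hypergames $x,y\in\mathcal J$, $$\gamma(x+y)=\gamma(x)\oplus\gamma(y).$$
   Context: Impartial hypergames: work in a universe of possibly non-wellfounded sets (set theory with the Antifoundation Axiom, and the Axiom of Choice). The class $\mathcal J$ of impartial hypergames is the carrier of the final coalgebra of the powerset functor $\mathcal P$ (on classes); so an impartial hypergame $x$ is a possibly non-wellfounded set of impartial hypergames (its options). Equality is bisimilarity of sets. Sum (coinductively): $x+y=\{x'+y\mid x'\in x\}\cup\{x+y'\mid y'\in y\}$. Generalized Grundy numbers: the ordinals and the formal symbols $\infty_K$ for $K\subseteq\mathrm{Ord}$ a set; $\infty$ denotes $\infty_\emptyset$. Generalized Nim sum: for ordinals $\alpha,\beta$, $\alpha\oplus\beta$ is the Nim sum, i.e. binary sum without carries (for infinite ordinals, using base-2 expansions). It is extended by $\alpha\oplus\infty_K=\infty_K\oplus\alpha=\infty_{\{k\oplus\alpha\mid k\in K\}}$ and $\infty_K\oplus\infty_H=\infty$. Generalized Grundy function: $\mathrm{mex}(S)$ is the least ordinal not in the set $S$ of ordinals. Order $\mathrm{Ord}\cup\{\bot\}$ by the flat order with bottom $\bot$, and functions $\mathcal J\to\mathrm{Ord}\cup\{\bot\}$ pointwise. For such $f$ let $\mathcal F_f(x)=\{f(y)\mid y\in x,\ f(y)\ne\bot\}$. Let $D$ be the subspace of those $f$ such that for all $x$, if $f(x)=\alpha\in\mathrm{Ord}$ then $\alpha=\mathrm{mex}(\mathcal F_f(x))$ and for every $y\in x$ with $f(y)=\bot$ there is $z\in y$ with $f(z)=\mathrm{mex}(\mathcal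 F_f(x))$. Define $T:D\to D$ by $T(f)(x)=\mathrm{mex}(\mathcal F_f(x))$ if for every $y\in x$ with $f(y)=\bot$ there is $z\in y$ with $f(z)=\mathrm{mex}(\mathcal F_f(x))$, and $T(f)(x)=\bot$ otherwise. Let $\gamma_0$ be the least fixpoint of $T$, obtained by transfinitely iterating $T$ from the constant function $\bot$. Then $\gamma(x)=\gamma_0(x)$ if $\gamma_0(x)\in\mathrm{Ord}$, and otherwise $\gamma(x)=\infty_K$ with $K=\{\gamma_0(y)\mid y\in x,\ \gamma_0(y)\neq\bot\}$. -}

module Defs where

open import Axiom.ExcludedMiddle using (ExcludedMiddle)
open import Data.Empty using (⊥; ⊥-elim)
open import Data.List.Base using (List; []; _∷_)
open import Data.List.Relation.Unary.Linked as Linked using (Linked; []; [-]; _∷_)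
open import Data.Product.Base using (Σ; Σ-syntax; _×_; _,_; proj₁; proj₂)
open import Data.Sum.Base as Sum using (_⊎_; inj₁; inj₂; [_,_]′)
open import Data.Unit.Base using (⊤; tt)
open import Function.Base using (flip)
open import Function.Bundles using (Func)
open import Induction.WellFounded using (Acc; acc; WellFounded)
open import Level using (Level; 0ℓ; Lift; lift; lower) renaming (suc to lsuc)
open import Relation.Binary.Bundles using (Setoid)
open import Relation.Binary.Core using (Rel)
open import Relation.Binary.Definitions using (Trichotomous; Tri; tri<; tri≈; tri>)
open import Relation.Binary.PropositionalEquality.Core using (_≡_; refl)
open import Relation.Binary.Structures using (IsEquivalence)
open import Relation.Nullary.Construct.Add.Infimum using (_₋; ⊥₋; [_])
open import Relation.Nullary.Decidable.Core using (yes; no; True; toWitness; fromWitness)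
open import Relation.Nullary.Negation.Core using (¬_)

1ℓ : Level
1ℓ = lsuc 0ℓ

-- The "sets" of the set theory are the families indexed by a type in Set; its
-- classes are types in Set₁ equipped with an equivalence relation.

------------------------------------------------------------------------

-- sup I f denotes the least ordinal strictly above every f i.  Different
-- trees may denote the same ordinal, so that equality of ordinals is _≈_.

data Ord : Set₁ where
  sup : (I : Set) → (I → Ord) → Ord

infix 4 _≤_ _<_ _≈_

data _≤_ : Rel Ord 1ℓ
data _<_ : Rel Ord 1ℓ

data _≤_ where
  sup≤ : ∀ {I f β} → (∀ i → f i < β) → sup I f ≤ β

data _<_ where
  <sup : ∀ {α J g} (j : J) → α ≤ g j → α < sup J g

_≈_ : Rel Ord 1ℓ
α ≈ β = α ≤ β × β ≤ α

<sup⁻¹ : ∀ {α J g} → α < sup J g → Σ[ j ∈ J ] α ≤ g j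
<sup⁻¹ (<sup j p) = j , p

≤-refl : ∀ {α} → α ≤ α
≤-refl {sup I f} = sup≤ λ i → <sup i ≤-refl

≤-trans   : ∀ {α β γ} → α ≤ β → β ≤ γ → α ≤ γ
<-≤-trans : ∀ {α β γ} → α < β → β ≤ γ → α < γ
≤-<-trans : ∀ {α β γ} → α ≤ β → β < γ → α < γ
≤-trans   (sup≤ p)   q          = sup≤ λ i → <-≤-trans (p i) q
<-≤-trans (<sup j p) (sup≤ q)   = ≤-<-trans p (q j)
≤-<-trans p          (<sup j q) = <sup j (≤-trans p q)

<⇒≤ : ∀ {α β} → α < β → α ≤ β
<⇒≤ (<sup j (sup≤ p)) = sup≤ λ i → <sup j (<⇒≤ (p i))

<-trans : ∀ {α β γ} → α < β → β < γ → α < γ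
<-trans p q = <-≤-trans p (<⇒≤ q)

<-irrefl : ∀ {α} → ¬ α < α
<-irrefl {sup I f} (<sup i (sup≤ p)) = <-irrefl (p i)

≤⇒≯ : ∀ {α β} → α ≤ β → ¬ β < α
≤⇒≯ p q = <-irrefl (≤-<-trans p q)

≈-refl : ∀ {α} → α ≈ α
≈-refl = ≤-refl , ≤-refl

≈-sym : ∀ {α β} → α ≈ β → β ≈ α
≈-sym (p , q) = q , p

≈-trans : ∀ {α β γ} → α ≈ β → β ≈ γ → α ≈ γ
≈-trans (p , q) (r , s) = ≤-trans p r , ≤-trans s q

≈-isEquivalence : IsEquivalence _≈_
≈-isEquivalence = record { refl = ≈-refl ; sym = ≈-sym ; trans = ≈-trans }

<-wellFounded : WellFounded _<_
<-wellFounded α = go α ≤-refl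
  where
  go : ∀ α {β} → β ≤ α → Acc _<_ β
  go (sup I f) β≤α = acc λ γ<β → helper (<-≤-trans γ<β β≤α)
    where
    helper : ∀ {γ} → γ < sup I f → Acc _<_ γ
    helper (<sup i γ≤fi) = go (f i) γ≤fi

------------------------------------------------------------------------

𝟘 : Ord
𝟘 = sup ⊥ λ ()

suc : Ord → Ord
suc α = sup ⊤ λ _ → α

-- Least upper bounds that, unlike sup, need not be strict.

infixr 6 _∨_

_∨_ : Ord → Ord → Ord
sup I f ∨ sup J g = sup (I ⊎ J) [ f , g ]′

Branch : Ord → Set
Branch (sup I f) = I

branch : ∀ α → Branch α → Ord
branch (sup I f) = f

⋁ : (I : Set) → (I → Ord) → Ord
⋁ I f = sup (Σ[ i ∈ I ] Branch (f i)) λ (i , b) → branch (f i) b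

infixr 7 _+ₒ_
infix  8 2^_

-- α + β is the least ordinal that is ≥ α and > α + β′ for all β′ < β.

_+ₒ_ : Ord → Ord → Ord
α +ₒ sup J g = α ∨ sup J λ j → α +ₒ g j

-- 2^ α is the least ordinal that is ≥ 1 and ≥ 2^ β · 2 for all β < α.

2^_ : Ord → Ord
2^ sup I f = suc 𝟘 ∨ ⋁ I λ i → 2^ f i +ₒ 2^ f i

∨-introˡ : ∀ {α β γ} → α < β → α < β ∨ γ
∨-introˡ {γ = sup _ _} (<sup i p) = <sup (inj₁ i) p

∨-introʳ : ∀ {α β γ} → α < γ → α < β ∨ γ
∨-introʳ {β = sup _ _} (<sup j p) = <sup (inj₂ j) p

∨-elim : ∀ {α β γ} → α < β ∨ γ → α < β ⊎ α < γ
∨-elim {β = sup _ _} {γ = sup _ _} (<sup (inj₁ i) p) = inj₁ (<sup i p)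
∨-elim {β = sup _ _} {γ = sup _ _} (<sup (inj₂ j) p) = inj₂ (<sup j p)

⋁-intro : ∀ {I f α} i → α < f i → α < ⋁ I f
⋁-intro {f = f} i p = let (b , q) = helper p in <sup (i , b) q
  where
  helper : ∀ {α β} → α < β → Σ[ b ∈ Branch β ] α ≤ branch β b
  helper (<sup b p) = b , p

⋁-elim : ∀ {I f α} → α < ⋁ I f → Σ[ i ∈ I ] α < f i
⋁-elim {f = f} (<sup (i , b) p) = i , helper (f i) b p
  where
  helper : ∀ {α} β b → α ≤ branch β b → α < β
  helper (sup _ _) b p = <sup b p

∨-least : ∀ {α β γ} → α ≤ γ → β ≤ γ → α ∨ β ≤ γ
∨-least (sup≤ p) (sup≤ q) = sup≤ λ { (inj₁ i) → p i ; (inj₂ j) → q j }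

+ₒ-increasing : ∀ {α} β → α ≤ α +ₒ β
+ₒ-increasing {sup I f} (sup J g) = sup≤ λ i → <sup (inj₁ i) ≤-refl

+ₒ-strict : ∀ {α β} → 𝟘 < β → α < α +ₒ β
+ₒ-strict {α} {sup J g} (<sup j _) = ∨-introʳ (<sup j (+ₒ-increasing (g j)))

+ₒ-monoʳ-≤ : ∀ α {β γ} → β ≤ γ → α +ₒ β ≤ α +ₒ γ
+ₒ-monoʳ-< : ∀ α {β γ} → β < γ → α +ₒ β < α +ₒ γ
+ₒ-monoʳ-≤ α {γ = γ} (sup≤ p)  = ∨-least (+ₒ-increasing γ) (sup≤ λ i → +ₒ-monoʳ-< α (p i))
+ₒ-monoʳ-< α         (<sup j p) = ∨-introʳ {β = α} (<sup j (+ₒ-monoʳ-≤ α p))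

2^-positive : ∀ α → 𝟘 < 2^ α
2^-positive (sup I f) = ∨-introˡ {γ = ⋁ I λ i → 2^ f i +ₒ 2^ f i} (<sup tt ≤-refl)

2^-expanding : ∀ α → α ≤ 2^ α
2^-expanding (sup I f) = sup≤ λ i →
  ∨-introʳ {β = suc 𝟘} (⋁-intro {f = λ i → 2^ f i +ₒ 2^ f i} i
    (≤-<-trans (2^-expanding (f i)) (+ₒ-strict (2^-positive (f i)))))

<2^suc : ∀ α → α < 2^ suc α
<2^suc α = ∨-introʳ {β = suc 𝟘} (⋁-intro {f = λ (_ : ⊤) → 2^ α +ₒ 2^ α} tt
  (≤-<-trans (2^-expanding α) (+ₒ-strict (2^-positive α))))

------------------------------------------------------------------------

record SetOfOrd : Set₁ where
  constructor family
  field
    Index : Set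
    at    : Index → Ord

open SetOfOrd public

infix 4 _∈_ _∉_ _⊆_ _≋_

_∈_ _∉_ : Ord → SetOfOrd → Set₁
α ∈ K = Σ[ i ∈ Index K ] α ≈ at K i
α ∉ K = ¬ α ∈ K

_⊆_ _≋_ : Rel SetOfOrd 1ℓ
K ⊆ H = ∀ {α} → α ∈ K → α ∈ H
K ≋ H = K ⊆ H × H ⊆ K

∅ : SetOfOrd
∅ = family ⊥ λ ()

image : (Ord → Ord) → SetOfOrd → SetOfOrd
image h K = family (Index K) λ i → h (at K i)

------------------------------------------------------------------------

infix 4 _≈ᴳ_

data Grundy : Set₁ where
  ord : Ord → Grundy
  ∞[_] : SetOfOrd → Grundy

∞ : Grundy
∞ = ∞[ ∅ ]

data _≈ᴳ_ : Rel Grundy 1ℓ where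
  ord  : ∀ {α β} → α ≈ β → ord α ≈ᴳ ord β
  ∞[_] : ∀ {K H} → K ≋ H → ∞[ K ] ≈ᴳ ∞[ H ]

------------------------------------------------------------------------

-- Under the Antifoundation Axiom every pointed (small, directed) graph
-- depicts exactly one set, every set is depicted by such a graph, and two
-- graphs depict the same set exactly when they are bisimilar.

record Graph : Set₁ where
  field
    Node   : Set
    Arrow  : Node → Set
    target : ∀ n → Arrow n → Node

open Graph public

record 𝒥 : Set₁ where
  constructor _at-node_
  field
    graph : Graph
    root  : Node graph

open 𝒥 public

Opt : 𝒥 → Set
Opt (G at-node n) = Arrow G n

opt : (x : 𝒥) → Opt x → 𝒥
opt (G at-node n) i = G at-node target G n i

record IsBisimulation (G H : Graph) (R : Node G → Node H → Set) : Set where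
  field
    forth : ∀ {m n} → R m n → ∀ i → Σ[ j ∈ Arrow H n ] R (target G m i) (target H n j)
    back  : ∀ {m n} → R m n → ∀ j → Σ[ i ∈ Arrow G m ] R (target G m i) (target H n j)

open IsBisimulation public

infix 4 _∼_

_∼_ : Rel 𝒥 1ℓ
x ∼ y = Σ[ R ∈ (Node (graph x) → Node (graph y) → Set) ]
          IsBisimulation (graph x) (graph y) R × R (root x) (root y)

∼-refl : ∀ {x} → x ∼ x
∼-refl = _≡_ , record { forth = λ { refl i → i , refl } ; back = λ { refl j → j , refl } } , refl

∼-sym : ∀ {x y} → x ∼ y → y ∼ x
∼-sym (R , bis , r) = flip R , record { forth = back bis ; back = forth bis } , r

∼-trans : ∀ {x y z} → x ∼ y → y ∼ z → x ∼ z
∼-trans (R , bisR , r) (S , bisS , s) =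
  (λ m o → Σ[ n ∈ _ ] R m n × S n o) ,
  record
    { forth = λ (_ , r , s) i → let (j , r′) = forth bisR r i
                                    (k , s′) = forth bisS s j
                                in k , _ , r′ , s′
    ; back  = λ (_ , r , s) k → let (j , s′) = back bisS s k
                                    (i , r′) = back bisR r j
                                in i , _ , r′ , s′
    } ,
  (_ , r , s)

∼-forth : ∀ {x y} → x ∼ y → ∀ i → Σ[ j ∈ Opt y ] opt x i ∼ opt y j
∼-forth (R , bis , r) i = let (j , r′) = forth bis r i in j , R , bis , r′

𝒥-setoid : Setoid 1ℓ 1ℓ
𝒥-setoid = record
  { Carrier = 𝒥
  ; _≈_ = _∼_
  ; isEquivalence = record { refl = ∼-refl ; sym = ∼-sym ; trans = ∼-trans }
  }

-- opt (x + y) (inj₁ i) is opt x i + y, and opt (x + y) (inj₂ j) is x + opt y j.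

infixl 6 _+_

_+_ : 𝒥 → 𝒥 → 𝒥
(G at-node m) + (H at-node n) = G□H at-node (m , n)
  where
  G□H : Graph
  Node   G□H         = Node G × Node H
  Arrow  G□H (m , n) = Arrow G m ⊎ Arrow H n
  target G□H (m , n) (inj₁ i) = target G m i , n
  target G□H (m , n) (inj₂ j) = m , target H n j

-- With unfold-isMorphism and unfold-unique, 𝒥 up to _∼_ is the carrier of the
-- final coalgebra of the powerset functor on classes.

record Coalgebra : Set₂ where
  field
    State : Set₁
    Out   : State → Set
    out   : ∀ x → Out x → State

open Coalgebra public

IsMorphism : (C : Coalgebra) → (State C → 𝒥) → Set₁
IsMorphism C h = ∀ x →
  (∀ i → Σ[ j ∈ Opt (h x) ] opt (h x) j ∼ h (out C x i)) ×
  (∀ j → Σ[ i ∈ Out C x ]   opt (h x) j ∼ h (out C x i))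

module Unfold (C : Coalgebra) where

  data Path (x : State C) : Set where
    ε   : Path x
    _◅_ : (i : Out C x) → Path (out C x i) → Path x

  end : ∀ {x} → Path x → State C
  end {x} ε = x
  end (i ◅ p) = end p

  _▻_ : ∀ {x} (p : Path x) → Out C (end p) → Path x
  ε       ▻ j = j ◅ ε
  (i ◅ p) ▻ j = i ◅ (p ▻ j)

  unfold : State C → 𝒥
  unfold x = record { Node = Path x ; Arrow = λ p → Out C (end p) ; target = _▻_ } at-node ε

  unfold-step : ∀ x i → opt (unfold x) i ∼ unfold (out C x i)
  unfold-step x i = (λ p q → p ≡ i ◅ q) ,
    record
      { forth = λ { refl j → j , refl }
      ; back  = λ { refl j → j , refl }
      } ,
    refl

  unfold-isMorphism : IsMorphism C unfold
  unfold-isMorphism x = (λ i → i , unfold-step x i) , λ i → i , unfold-step x i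

  end-▻ : ∀ {x} (p : Path x) i → end (p ▻ i) ≡ out C (end p) i
  end-▻ ε       i = refl
  end-▻ (_ ◅ p) i = end-▻ p i

------------------------------------------------------------------------

open import Relation.Binary.Construct.Add.Infimum.Equality _≈_ public
  using (_≈₋_; ⊥₋≈⊥₋; [_]; ≈₋-refl; ≈₋-sym; ≈₋-trans; ≈₋-isEquivalence)

-- The flat order is the order obtained by adding a bottom to the discrete
-- order _≈_.

open import Relation.Binary.Construct.Add.Infimum.NonStrict _≈_ public
  using ([_]; ⊥₋≤_; ≤₋-trans) renaming (_≤₋_ to _⊑₋_)

Ord₋-setoid : Setoid 1ℓ 1ℓ
Ord₋-setoid = record { isEquivalence = ≈₋-isEquivalence ≈-isEquivalence }

Defined : Ord ₋ → Set
Defined ⊥₋    = ⊥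
Defined [ _ ] = ⊤

the : (m : Ord ₋) → Defined m → Ord
the [ α ] _ = α

infix 4 _⊑_

_⊑_ : Rel (𝒥 → Ord ₋) 1ℓ
f ⊑ g = ∀ x → f x ⊑₋ g x

𝓕 : (𝒥 → Ord ₋) → 𝒥 → SetOfOrd
𝓕 f x = family (Σ[ i ∈ Opt x ] Defined (f (opt x i))) λ (i , d) → the (f (opt x i)) d

⊑₋-intro : ∀ {m n} → (∀ {α} → m ≈₋ [ α ] → n ≈₋ [ α ]) → m ⊑₋ n
⊑₋-intro {⊥₋}    p = ⊥₋≤ _
⊑₋-intro {[ α ]} p with p [ ≈-refl ]
... | [ q ] = [ ≈-sym q ]

⊑₋-elim : ∀ {m n α} → m ⊑₋ n → m ≈₋ [ α ] → n ≈₋ [ α ]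
⊑₋-elim [ p ] [ q ] = [ ≈-trans (≈-sym p) q ]

⊑₋-reflexive : ∀ {m n} → m ≈₋ n → m ⊑₋ n
⊑₋-reflexive ⊥₋≈⊥₋ = ⊥₋≤ _
⊑₋-reflexive [ p ] = [ p ]

⊑₋-antisym : ∀ {m n} → m ⊑₋ n → n ⊑₋ m → m ≈₋ n
⊑₋-antisym (⊥₋≤ _) (⊥₋≤ _) = ⊥₋≈⊥₋
⊑₋-antisym [ p ] _ = [ p ]

⊑₋-⊥ : ∀ {m n} → m ⊑₋ n → n ≈₋ ⊥₋ → m ≈₋ ⊥₋
⊑₋-⊥ (⊥₋≤ _) _ = ⊥₋≈⊥₋

≈₋-deterministic : ∀ {m α β} → m ≈₋ [ α ] → m ≈₋ [ β ] → α ≈ β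
≈₋-deterministic [ p ] [ q ] = ≈-trans (≈-sym p) q

≈₋-respʳ : ∀ {m α β} → α ≈ β → m ≈₋ [ α ] → m ≈₋ [ β ]
≈₋-respʳ p [ q ] = [ ≈-trans q p ]

defined : ∀ {m} → Defined m → Σ[ α ∈ Ord ] m ≈₋ [ α ]
defined {[ α ]} _ = α , [ ≈-refl ]

≈₋⇒Defined : ∀ {m α} → m ≈₋ [ α ] → Defined m
≈₋⇒Defined [ _ ] = tt

∈𝓕⁺ : ∀ f x {α} i → f (opt x i) ≈₋ [ α ] → α ∈ 𝓕 f x
∈𝓕⁺ f x i p = (i , ≈₋⇒Defined p) , helper p
  where
  helper : ∀ {m α} (p : m ≈₋ [ α ]) → α ≈ the m (≈₋⇒Defined p)
  helper [ q ] = ≈-sym q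

∈𝓕⁻ : ∀ f x {α} → α ∈ 𝓕 f x → Σ[ i ∈ Opt x ] f (opt x i) ≈₋ [ α ]
∈𝓕⁻ f x ((i , d) , p) = i , helper (f (opt x i)) d p
  where
  helper : ∀ m d {α} → α ≈ the m d → m ≈₋ [ α ]
  helper [ _ ] _ q = [ ≈-sym q ]

------------------------------------------------------------------------
-- The ambient set theory is classical.  Choice is not used.

module Classical (em : ExcludedMiddle 1ℓ) where

  module _ (C : Coalgebra) where
    open Unfold C

    unfold-unique : ∀ h → IsMorphism C h → ∀ x → h x ∼ unfold x
    unfold-unique h h-mor x = R ,
      record { forth = λ {n} {p} → forth′ {n} {p} ; back = λ {n} {p} → back′ {n} {p} } , fromWitness ∼-refl
      where
      node : Node (graph (h x)) → 𝒥
      node n = graph (h x) at-node n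
      R : Node (graph (h x)) → Path x → Set
      R n p = True (em {node n ∼ h (end p)})
      next : ∀ {n} {p : Path x} i → node n ∼ h (out C (end p) i) → R n (p ▻ i)
      next {n} {p} i q = fromWitness (helper (end-▻ p i) q)
        where
        helper : ∀ {y z} → y ≡ z → node n ∼ h z → node n ∼ h y
        helper refl q = q
      forth′ : ∀ {n p} → R n p → ∀ i →
               Σ[ j ∈ Out C (end p) ] R (target (graph (h x)) n i) (p ▻ j)
      forth′ {n} {p} r i =
        let (k , q) = ∼-forth (toWitness r) i
            (j , s) = proj₂ (h-mor (end p)) k
        in j , next {p = p} j (∼-trans q s)
      back′ : ∀ {n p} → R n p → ∀ j →
              Σ[ i ∈ Arrow (graph (h x)) n ] R (target (graph (h x)) n i) (p ▻ j)
      back′ {n} {p} r j =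
        let (k , s) = proj₁ (h-mor (end p)) j
            (i , q) = ∼-forth (∼-sym (toWitness r)) k
        in i , next {p = p} j (∼-trans (∼-sym q) s)

  ----------------------------------------------------------------------

  <⊎≥ : ∀ α β → α < β ⊎ β ≤ α
  <⊎≥ α (sup J g) with em {Σ[ j ∈ J ] α ≤ g j}
  ... | yes (j , p) = inj₁ (<sup j p)
  ... | no  ¬p      = inj₂ (sup≤ λ j → helper j (<⊎≥ (g j) α))
    where
    helper : ∀ j → g j < α ⊎ α ≤ g j → g j < α
    helper j (inj₁ q) = q
    helper j (inj₂ q) = ⊥-elim (¬p (j , q))

  ≤-total : ∀ α β → α ≤ β ⊎ β ≤ α
  ≤-total α β = Sum.map₁ <⇒≤ (<⊎≥ α β)

  compare : Trichotomous _≈_ _<_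
  compare α β with <⊎≥ α β | <⊎≥ β α
  ... | inj₁ p | _      = tri< p (λ q → ≤⇒≯ (proj₂ q) p) (λ q → <-irrefl (<-trans p q))
  ... | inj₂ p | inj₁ q = tri> (≤⇒≯ p) (λ r → ≤⇒≯ (proj₁ r) q) q
  ... | inj₂ p | inj₂ q = tri≈ (≤⇒≯ p) (q , p) (≤⇒≯ q)

  Least : (Ord → Set₁) → Ord → Set₁
  Least P μ = P μ × (∀ β → P β → μ ≤ β)

  least : (P : Ord → Set₁) → Σ Ord P → Σ Ord (Least P)
  least P (α , pα) = go (<-wellFounded α) pα
    where
    go : ∀ {α} → Acc _<_ α → P α → Σ Ord (Least P)
    go {α} (acc rec) pα with em {Σ[ β ∈ Ord ] β < α × P β}
    ... | yes (β , β<α , pβ) = go (rec β<α) pβ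
    ... | no  ¬smaller       = α , pα , λ β pβ →
      [ (λ β<α → ⊥-elim (¬smaller (β , β<α , pβ))) , (λ α≤β → α≤β) ]′ (<⊎≥ β α)

  strict-sup-∉ : ∀ K → sup (Index K) (at K) ∉ K
  strict-sup-∉ K (i , (p , _)) = <-irrefl (≤-<-trans p (<sup i ≤-refl))

  leastOutside : ∀ K → Σ Ord (Least (_∉ K))
  leastOutside K = least (_∉ K) (sup (Index K) (at K) , strict-sup-∉ K)

  mex : SetOfOrd → Ord
  mex K = proj₁ (leastOutside K)

  mex-∉ : ∀ K → mex K ∉ K
  mex-∉ K = proj₁ (proj₂ (leastOutside K))

  mex-least : ∀ K β → β ∉ K → mex K ≤ β
  mex-least K = proj₂ (proj₂ (leastOutside K))

  -- Adjoining elements other than the mex does not change it.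

  mex-extend : ∀ K H → K ⊆ H → mex K ∉ H → mex K ≈ mex H
  mex-extend K H K⊆H μ∉H =
    mex-least K (mex H) (λ p → mex-∉ H (K⊆H p)) , mex-least H (mex K) μ∉H

  mex-cong : ∀ K H → K ≋ H → mex K ≈ mex H
  mex-cong K H (K⊆H , H⊆K) = mex-extend K H K⊆H (λ p → mex-∉ K (H⊆K p))

  ----------------------------------------------------------------------

  -- value (e₁ ∷ … ∷ eₙ ∷ []) is 2^ e₁ + … + 2^ eₙ; the list is a base-2
  -- expansion if the exponents are strictly decreasing.

  value : List Ord → Ord
  value []       = 𝟘
  value (e ∷ es) = 2^ e +ₒ value es

  record Base2 (α : Ord) : Set₁ where
    field
      exponents  : List Ord
      decreasing : Linked (flip _<_) exponents
      correct    : value exponents ≈ α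

  open Base2 public

  subtract : ∀ α β δ → α ≤ δ → δ < α +ₒ β → Σ[ ρ ∈ Ord ] ρ < β × δ ≈ α +ₒ ρ
  subtract α (sup J g) δ α≤δ δ< with ∨-elim {β = α} δ<
  ... | inj₁ δ<α = ⊥-elim (≤⇒≯ α≤δ δ<α)
  ... | inj₂ (<sup j δ≤) with <⊎≥ δ (α +ₒ g j)
  ...   | inj₁ δ<′ = let (ρ , ρ<gj , δ≈) = subtract α (g j) δ α≤δ δ<′
                     in ρ , <-trans ρ<gj (<sup j ≤-refl) , δ≈
  ...   | inj₂ ≤δ  = g j , <sup j ≤-refl , (δ≤ , ≤δ)

  weakenHead : ∀ {e e′ es} → e ≤ e′ → Linked (flip _<_) (e ∷ es) → Linked (flip _<_) (e′ ∷ es)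
  weakenHead p [-]      = [-]
  weakenHead p (q ∷ qs) = <-≤-trans q p ∷ qs

  expand : ∀ e α → α < 2^ e →
           Σ[ es ∈ List Ord ] Linked (flip _<_) (e ∷ es) × value es ≈ α
  expand (sup I f) α α< with ∨-elim {β = suc 𝟘} α<
  ... | inj₁ (<sup tt α≤𝟘) = [] , [-] , (sup≤ (λ ()) , α≤𝟘)
  ... | inj₂ α<⋁ with ⋁-elim {f = λ i → 2^ f i +ₒ 2^ f i} α<⋁
  ...   | i , α<double with <⊎≥ α (2^ f i)
  ...     | inj₁ α<2^fi =
              let (es , es-dec , es≈α) = expand (f i) α α<2^fi
              in es , weakenHead (<⇒≤ (<sup i ≤-refl)) es-dec , es≈α
  ...     | inj₂ 2^fi≤α =
              let (ρ , ρ<2^fi , α≈) = subtract (2^ f i) (2^ f i) α 2^fi≤α α<double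
                  (es , es-dec , (es≤ρ , ρ≤es)) = expand (f i) ρ ρ<2^fi
              in f i ∷ es , <sup i ≤-refl ∷ es-dec ,
                 ≈-trans (+ₒ-monoʳ-≤ (2^ f i) es≤ρ , +ₒ-monoʳ-≤ (2^ f i) ρ≤es) (≈-sym α≈)

  base2 : ∀ α → Base2 α
  base2 α = let (es , es-dec , es≈α) = expand (suc α) α (<2^suc α) in record
    { exponents = es ; decreasing = Linked.tail es-dec ; correct = es≈α }

  byCases : ∀ {A B C : Set₁} {X : Set₁} → Tri A B C → X → X → X → X
  byCases (tri< _ _ _) x y z = x
  byCases (tri≈ _ _ _) x y z = y
  byCases (tri> _ _ _) x y z = z

  -- For strictly decreasing lists this is the decreasing list of the elements
  -- of exactly one of them, so adding base-2 expansions discards all carries.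

  infixr 6 _△_

  _△_ : List Ord → List Ord → List Ord
  []       △ bs       = bs
  (a ∷ as) △ []       = a ∷ as
  (a ∷ as) △ (b ∷ bs) = byCases (compare a b)
    (b ∷ ((a ∷ as) △ bs))
    (as △ bs)
    (a ∷ (as △ (b ∷ bs)))

  infixl 6 _⊕ₒ_ _⊕_

  _⊕ₒ_ : Ord → Ord → Ord
  α ⊕ₒ β = value (exponents (base2 α) △ exponents (base2 β))

  _⊕_ : Grundy → Grundy → Grundy
  ord α  ⊕ ord β  = ord (α ⊕ₒ β)
  ord α  ⊕ ∞[ K ] = ∞[ image (_⊕ₒ α) K ]
  ∞[ K ] ⊕ ord α  = ∞[ image (_⊕ₒ α) K ]
  ∞[ K ] ⊕ ∞[ H ] = ∞

  ----------------------------------------------------------------------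

  Answered : (𝒥 → Ord ₋) → 𝒥 → Set₁
  Answered f x = ∀ (y : Opt x) → f (opt x y) ≈₋ ⊥₋ →
    Σ[ z ∈ Opt (opt x y) ] f (opt (opt x y) z) ≈₋ [ mex (𝓕 f x) ]

  InD : (𝒥 → Ord ₋) → Set₁
  InD f = ∀ x {α} → f x ≈₋ [ α ] → α ≈ mex (𝓕 f x) × Answered f x

  -- As equality of hypergames is bisimilarity, functions on them respect it.

  record D : Set₁ where
    field
      fun : Func 𝒥-setoid Ord₋-setoid
      inD : InD (Func.to fun)
    open Func fun public

  open D public using (fun; inD; cong) renaming (to to ⟦_⟧)

  T-fun : (𝒥 → Ord ₋) → 𝒥 → Ord ₋
  T-fun f x with em {Answered f x}
  ... | yes _ = [ mex (𝓕 f x) ]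
  ... | no  _ = ⊥₋

  T-intro : ∀ f x {α} → Answered f x → α ≈ mex (𝓕 f x) → T-fun f x ≈₋ [ α ]
  T-intro f x ans p with em {Answered f x}
  ... | yes _  = [ ≈-sym p ]
  ... | no  ¬a = ⊥-elim (¬a ans)

  T-elim : ∀ f x {α} → T-fun f x ≈₋ [ α ] → α ≈ mex (𝓕 f x) × Answered f x
  T-elim f x p with em {Answered f x}
  T-elim f x [ p ] | yes a = ≈-sym p , a

  -- A lower stage f and a higher stage h are coherent if no game has, at
  -- stage h, a value that one of its options already has at stage f.

  Coherent : (f h : 𝒥 → Ord ₋) → Set₁
  Coherent f h = ∀ y z {α} → h y ≈₋ [ α ] → ¬ f (opt y z) ≈₋ [ α ]

  T-mono′ : ∀ f h → f ⊑ h → Coherent f h → T-fun f ⊑ T-fun h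
  T-mono′ f h f⊑h coh x = ⊑₋-intro λ p →
    let (α≈ , ans) = T-elim f x p
    in T-intro h x (ans′ ans) (≈-trans α≈ (μ≈ ans))
    where
    μ : Ord
    μ = mex (𝓕 f x)
    sub : 𝓕 f x ⊆ 𝓕 h x
    sub q = let (i , r) = ∈𝓕⁻ f x q in ∈𝓕⁺ h x i (⊑₋-elim (f⊑h _) r)
    case : ∀ {m n} → m ⊑₋ n → n ≈₋ [ μ ] → (m ≈₋ [ μ ]) ⊎ (m ≈₋ ⊥₋)
    case (⊥₋≤ _) _     = inj₂ ⊥₋≈⊥₋
    case [ p ]   [ q ] = inj₁ [ ≈-trans p q ]
    μ∉ : Answered f x → μ ∉ 𝓕 h x
    μ∉ ans q with ∈𝓕⁻ h x q
    ... | i , r with case (f⊑h (opt x i)) r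
    ...   | inj₁ s = mex-∉ (𝓕 f x) (∈𝓕⁺ f x i s)
    ...   | inj₂ s = let (j , t) = ans i s in coh (opt x i) j r t
    μ≈ : Answered f x → μ ≈ mex (𝓕 h x)
    μ≈ ans = mex-extend (𝓕 f x) (𝓕 h x) sub (μ∉ ans)
    ans′ : Answered f x → Answered h x
    ans′ ans i p = let (j , q) = ans i (⊑₋-⊥ (f⊑h _) p)
                   in j , ≈₋-respʳ (μ≈ ans) (⊑₋-elim (f⊑h _) q)

  inD⇒coherent : ∀ {f h} → f ⊑ h → InD h → Coherent f h
  inD⇒coherent {h = h} f⊑h h∈D y z p q =
    let (α≈ , _) = h∈D y p
    in mex-∉ (𝓕 h y) (∈𝓕⁺ h y z (≈₋-respʳ α≈ (⊑₋-elim (f⊑h _) q)))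

  inD⇒postfixed : ∀ {f} → InD f → f ⊑ T-fun f
  inD⇒postfixed {f} f∈D x = ⊑₋-intro λ p → let (α≈ , ans) = f∈D x p in T-intro f x ans α≈

  T-inD : ∀ f → InD f → InD (T-fun f)
  T-inD f f∈D x p = T-elim (T-fun f) x (⊑₋-elim (T-mono′ f (T-fun f) (inD⇒postfixed f∈D) coh x) p)
    where
    coh : Coherent f (T-fun f)
    coh y z p q = let (α≈ , _) = T-elim f y p in mex-∉ (𝓕 f y) (∈𝓕⁺ f y z (≈₋-respʳ α≈ q))

  T-local : ∀ f g x y →
    (∀ i → Σ[ j ∈ Opt y ] f (opt x i) ≈₋ g (opt y j)) →
    (∀ j → Σ[ i ∈ Opt x ] f (opt x i) ≈₋ g (opt y j) ×
      (∀ k → Σ[ l ∈ Opt (opt y j) ] f (opt (opt x i) k) ≈₋ g (opt (opt y j) l))) →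
    T-fun f x ⊑₋ T-fun g y
  T-local f g x y to from = ⊑₋-intro λ p →
    let (α≈ , ans) = T-elim f x p
    in T-intro g y (ans′ ans) (≈-trans α≈ μ≈)
    where
    μ≈ : mex (𝓕 f x) ≈ mex (𝓕 g y)
    μ≈ = mex-cong (𝓕 f x) (𝓕 g y)
      ( (λ q → let (i , r) = ∈𝓕⁻ f x q ; (j , s) = to i
               in ∈𝓕⁺ g y j (≈₋-trans ≈-trans (≈₋-sym ≈-sym s) r))
      , (λ q → let (j , r) = ∈𝓕⁻ g y q ; (i , s , _) = from j
               in ∈𝓕⁺ f x i (≈₋-trans ≈-trans s r)))
    ans′ : Answered f x → Answered g y
    ans′ ans j p =
      let (i , q , u) = from j
          (k , r)     = ans i (≈₋-trans ≈-trans q p)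
          (l , s)     = u k
      in l , ≈₋-respʳ μ≈ (≈₋-trans ≈-trans (≈₋-sym ≈-sym s) r)

  T-cong : (f : Func 𝒥-setoid Ord₋-setoid) → ∀ {x y} → x ∼ y →
           T-fun (Func.to f) x ≈₋ T-fun (Func.to f) y
  T-cong f x∼y = ⊑₋-antisym (half x∼y) (half (∼-sym x∼y))
    where
    half : ∀ {x y} → x ∼ y → T-fun (Func.to f) x ⊑₋ T-fun (Func.to f) y
    half {x} {y} x∼y = T-local (Func.to f) (Func.to f) x y
      (λ i → let (j , p) = ∼-forth x∼y i in j , Func.cong f p)
      (λ j → let (i , p) = ∼-forth (∼-sym x∼y) j
             in i , Func.cong f (∼-sym p) , λ k →
                let (l , q) = ∼-forth (∼-sym p) k in l , Func.cong f q)

  T : D → D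
  T f = record
    { fun = record { to = T-fun ⟦ f ⟧ ; cong = T-cong (fun f) }
    ; inD = T-inD ⟦ f ⟧ (inD f)
    }

  T-mono : ∀ {f h} → ⟦ f ⟧ ⊑ ⟦ h ⟧ → ⟦ T f ⟧ ⊑ ⟦ T h ⟧
  T-mono {f} {h} f⊑h = T-mono′ ⟦ f ⟧ ⟦ h ⟧ f⊑h (inD⇒coherent f⊑h (inD h))

  ----------------------------------------------------------------------

  module _ {I : Set₁} (g : I → D)
           (chain : ∀ i j → ⟦ g i ⟧ ⊑ ⟦ g j ⟧ ⊎ ⟦ g j ⟧ ⊑ ⟦ g i ⟧) where

    private
      pick : 𝒥 → Ord ₋
      pick x with em {Σ[ i ∈ I ] Defined (⟦ g i ⟧ x)}
      ... | yes (i , _) = ⟦ g i ⟧ x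
      ... | no  _       = ⊥₋

      agree : ∀ i j x {α β} → ⟦ g i ⟧ x ≈₋ [ α ] → ⟦ g j ⟧ x ≈₋ [ β ] → α ≈ β
      agree i j x p q with chain i j
      ... | inj₁ i⊑j = ≈₋-deterministic (⊑₋-elim (i⊑j x) p) q
      ... | inj₂ j⊑i = ≈₋-deterministic p (⊑₋-elim (j⊑i x) q)

      pick-intro : ∀ i x {α} → ⟦ g i ⟧ x ≈₋ [ α ] → pick x ≈₋ [ α ]
      pick-intro i x p with em {Σ[ i ∈ I ] Defined (⟦ g i ⟧ x)}
      ... | yes (j , d) = let (β , q) = defined d in ≈₋-respʳ (agree j i x q p) q
      ... | no  ¬d      = ⊥-elim (¬d (i , ≈₋⇒Defined p))

      pick-elim : ∀ x {α} → pick x ≈₋ [ α ] → Σ[ i ∈ I ] ⟦ g i ⟧ x ≈₋ [ α ]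
      pick-elim x p with em {Σ[ i ∈ I ] Defined (⟦ g i ⟧ x)}
      ... | yes (i , _) = i , p

      pick-upper : ∀ i → ⟦ g i ⟧ ⊑ pick
      pick-upper i x = ⊑₋-intro (pick-intro i x)

      pick-coherent : ∀ i → Coherent ⟦ g i ⟧ pick
      pick-coherent i y z p q with pick-elim y p
      ... | j , r with chain i j
      ...   | inj₁ i⊑j = inD⇒coherent i⊑j (inD (g j)) y z r q
      ...   | inj₂ j⊑i = inD⇒coherent {⟦ g i ⟧} (λ x → ⊑₋-reflexive (≈₋-refl ≈-refl)) (inD (g i)) y z (⊑₋-elim (j⊑i y) r) q

      pick-cong : ∀ {x y} → x ∼ y → pick x ⊑₋ pick y
      pick-cong {x} {y} x∼y = ⊑₋-intro λ p →
        let (i , q) = pick-elim x p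
        in pick-intro i y (≈₋-trans ≈-trans (cong (g i) (∼-sym x∼y)) q)

      pick-inD : InD pick
      pick-inD x p =
        let (i , q) = pick-elim x p
        in T-elim pick x (⊑₋-elim
             (≤₋-trans ≈-trans (inD⇒postfixed (inD (g i)) x)
               (T-mono′ ⟦ g i ⟧ pick (pick-upper i) (pick-coherent i) x)) q)

    ⨆ : D
    ⨆ = record
      { fun = record
        { to   = pick
        ; cong = λ x∼y → ⊑₋-antisym (pick-cong x∼y) (pick-cong (∼-sym x∼y)) }
      ; inD = pick-inD
      }

    ⨆-upper : ∀ i → ⟦ g i ⟧ ⊑ ⟦ ⨆ ⟧
    ⨆-upper = pick-upper

    ⨆-elim : ∀ x {α} → ⟦ ⨆ ⟧ x ≈₋ [ α ] → Σ[ i ∈ I ] ⟦ g i ⟧ x ≈₋ [ α ]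
    ⨆-elim = pick-elim

    ⨆-least : ∀ h → (∀ i → ⟦ g i ⟧ ⊑ h) → ⟦ ⨆ ⟧ ⊑ h
    ⨆-least h up x = ⊑₋-intro λ p → let (i , q) = pick-elim x p in ⊑₋-elim (up i x) q

  ----------------------------------------------------------------------

  -- iterate α = ⨆_{β < α} T (iterate β): the constant function ⊥ at 0,
  -- T (iterate β) at a successor β + 1 and the supremum at limits.

  iterate       : Ord → D
  iterate-mono  : ∀ α β → α ≤ β → ⟦ iterate α ⟧ ⊑ ⟦ iterate β ⟧
  iterate-chain : ∀ α β → ⟦ T (iterate α) ⟧ ⊑ ⟦ T (iterate β) ⟧ ⊎
                          ⟦ T (iterate β) ⟧ ⊑ ⟦ T (iterate α) ⟧

  iterate (sup I f) = ⨆ {Lift 1ℓ I} (λ i → T (iterate (f (lower i))))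
    (λ i j → iterate-chain (f (lower i)) (f (lower j)))

  iterate-mono (sup I f) (sup J g) (sup≤ p) =
    ⨆-least {Lift 1ℓ I} (λ i → T (iterate (f (lower i))))
      (λ i j → iterate-chain (f (lower i)) (f (lower j)))
      ⟦ iterate (sup J g) ⟧
      (λ i x → let (j , fi≤gj) = <sup⁻¹ (p (lower i)) in ≤₋-trans ≈-trans
        (T-mono {iterate (f (lower i))} {iterate (g j)} (iterate-mono (f (lower i)) (g j) fi≤gj) x)
        (⨆-upper {Lift 1ℓ J} (λ j → T (iterate (g (lower j))))
          (λ i j → iterate-chain (g (lower i)) (g (lower j))) (lift j) x))

  iterate-chain α β = Sum.map
    (λ α≤β → T-mono {iterate α} {iterate β} (iterate-mono α β α≤β))
    (λ β≤α → T-mono {iterate β} {iterate α} (iterate-mono β α β≤α))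
    (≤-total α β)

  T-iterate : ∀ α → ⟦ T (iterate α) ⟧ ⊑ ⟦ iterate (suc α) ⟧
  T-iterate α = ⨆-upper {Lift 1ℓ ⊤} (λ _ → T (iterate α)) (λ _ _ → iterate-chain α α) (lift tt)

  iterates-chain : ∀ α β → ⟦ iterate α ⟧ ⊑ ⟦ iterate β ⟧ ⊎ ⟦ iterate β ⟧ ⊑ ⟦ iterate α ⟧
  iterates-chain α β = Sum.map (iterate-mono α β) (iterate-mono β α) (≤-total α β)

  γ₀ : D
  γ₀ = ⨆ iterate iterates-chain

  γ₀-upper : ∀ α → ⟦ iterate α ⟧ ⊑ ⟦ γ₀ ⟧
  γ₀-upper = ⨆-upper iterate iterates-chain

  stage : ∀ x → Σ[ α ∈ Ord ] ⟦ γ₀ ⟧ x ⊑₋ ⟦ iterate α ⟧ x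
  stage x with em {Σ[ α ∈ Ord ] Defined (⟦ iterate α ⟧ x)}
  ... | yes (α , _) = α , ⊑₋-reflexive (≈₋-refl ≈-refl)
  ... | no  _       = 𝟘 , ⊥₋≤ _

  γ₀-fixpoint : ∀ x → ⟦ T γ₀ ⟧ x ≈₋ ⟦ γ₀ ⟧ x
  γ₀-fixpoint x = ⊑₋-antisym
    (≤₋-trans ≈-trans (T-local ⟦ γ₀ ⟧ ⟦ iterate δ ⟧ x x
      (λ i → i , settled₁ i)
      (λ i → i , settled₁ i , λ k → k , settled₂ i k))
      (≤₋-trans ≈-trans (T-iterate δ x) (γ₀-upper (suc δ) x)))
    (inD⇒postfixed (inD γ₀) x)
    where
    stages : Σ[ i ∈ Opt x ] (⊤ ⊎ Opt (opt x i)) → Ord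
    stages (i , inj₁ _) = proj₁ (stage (opt x i))
    stages (i , inj₂ k) = proj₁ (stage (opt (opt x i) k))
    δ : Ord
    δ = sup _ stages
    settled : ∀ y → proj₁ (stage y) ≤ δ → ⟦ γ₀ ⟧ y ≈₋ ⟦ iterate δ ⟧ y
    settled y p = ⊑₋-antisym
      (≤₋-trans ≈-trans (proj₂ (stage y)) (iterate-mono _ δ p y))
      (γ₀-upper δ y)
    settled₁ : ∀ i → ⟦ γ₀ ⟧ (opt x i) ≈₋ ⟦ iterate δ ⟧ (opt x i)
    settled₁ i = settled (opt x i) (<⇒≤ (<sup (i , inj₁ tt) ≤-refl))
    settled₂ : ∀ i k → ⟦ γ₀ ⟧ (opt (opt x i) k) ≈₋ ⟦ iterate δ ⟧ (opt (opt x i) k)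
    settled₂ i k = settled (opt (opt x i) k) (<⇒≤ (<sup (i , inj₂ k) ≤-refl))

  γ₀-least : ∀ (h : D) → (∀ x → ⟦ T h ⟧ x ≈₋ ⟦ h ⟧ x) → ⟦ γ₀ ⟧ ⊑ ⟦ h ⟧
  γ₀-least h Th≈h = ⨆-least iterate iterates-chain ⟦ h ⟧ below
    where
    below : ∀ α → ⟦ iterate α ⟧ ⊑ ⟦ h ⟧
    below (sup I f) = ⨆-least {Lift 1ℓ I} (λ i → T (iterate (f (lower i))))
      (λ i j → iterate-chain (f (lower i)) (f (lower j))) ⟦ h ⟧ λ i x →
      ≤₋-trans ≈-trans (T-mono {iterate (f (lower i))} {h} (below (f (lower i))) x) (⊑₋-reflexive (Th≈h x))

  ----------------------------------------------------------------------

  grundy : Ord ₋ → SetOfOrd → Grundy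
  grundy [ α ] K = ord α
  grundy ⊥₋    K = ∞[ K ]

  γ : 𝒥 → Grundy
  γ x = grundy (⟦ γ₀ ⟧ x) (𝓕 ⟦ γ₀ ⟧ x)

{-# OPTIONS --safe #-}
module Submission where

-- Write x ⇓ α when γ₀ x is the ordinal α, and call such an x valued.
--
-- Ordinals.  A base-2 expansion is determined by its digits, two expansions
-- compare as their digits do at the highest place where they differ
-- (comparison), and the digits of a Nim sum are the exclusive ors of the
-- digits of the summands (bit-⊞).  Hence the Nim sum is commutative, each
-- summand can be recovered by adding the other one once more (⊞-cancelʳ), and
-- every δ < α ⊕ β arises by lowering exactly one summand (⊞-lower): if e is
-- the highest place where δ and α ⊕ β differ, then α, say, has digit 1 at e,
-- and δ ⊕ β < α because e also is the highest place where these two differ.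
--
-- Games.  The condition "α is a mex" is not monotone in the values of the
-- options, but γ₀ also is the least relation such that x ⇓ α as soon as
-- every β < α is the value of an option of x and every option of x either has
-- a value below α or has an option of value α (⇓-intro, ⇓-step): an option of
-- value above α has an option of value α.  The transfinite stages defining γ₀
-- provide the corresponding induction principle (⇓-induction).
--
-- If x ⇓ α and y ⇓ β, then x + y ⇓ α ⊕ β by induction on both hypotheses
-- (⇓-+), as for ordinary Nim sums.  Conversely, if x + y ⇓ δ then both
-- summands are valued (valued-+⁻).  By induction this may be assumed of the
-- options, and of the options of options, that witness x + y ⇓ δ.
-- * If y ⇓ β and x had no value, no witness could have the form x + y′, so
--   that all of them move in x; cancelling the values of y and of its options
--   gives x ⇓ δ ⊕ β after all (valuedˡ).
-- * If neither had a value, the reply to a move x′ + y would have to be a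
--   move in y, so that every x′ would be valued, and then so would be x
--   (one-valued).
--
-- So x + y is valued exactly if x and y are, and then γ is additive.  If
-- neither is, no option of x + y is valued; if only x is not, the valued
-- options are the x′ + y with x′ valued, which yields the required set.

open import Axiom.ExcludedMiddle using (ExcludedMiddle)
open import Data.Bool.Base using (Bool; true; false; _xor_)
open import Data.Bool.Properties using (xor-comm; xor-assoc; xor-same; xor-identityʳ)
open import Data.Empty using (⊥; ⊥-elim)
open import Data.List.Base using (List; []; _∷_)
open import Data.List.Relation.Unary.Linked as Linked using (Linked; []; [-]; _∷_)
open import Data.Product.Base using (Σ-syntax; _×_; _,_; proj₁; proj₂)
open import Data.Sum.Base as Sum using (_⊎_; inj₁; inj₂)
open import Data.Unit.Base using (tt)
open import Function.Base using (flip)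
open import Level using (lower)
open import Relation.Binary.Definitions using (Tri; tri<; tri≈; tri>)
open import Relation.Binary.PropositionalEquality using (_≡_; refl; sym; trans; cong; cong₂)
open import Relation.Nullary.Construct.Add.Infimum using (⊥₋; [_])
open import Relation.Nullary.Decidable using (yes; no; does; dec-true; dec-false)
open import Relation.Nullary.Negation.Core using (¬_)
open import Defs

------------------------------------------------------------------------
-- Ordinal arithmetic

≤-intro : ∀ {α β} → (∀ {δ} → δ < α → δ < β) → α ≤ β
≤-intro {sup I f} p = sup≤ λ i → p (<sup i ≤-refl)

+ₒ-monoˡ-≤ : ∀ {α α′} β → α ≤ α′ → α +ₒ β ≤ α′ +ₒ β
+ₒ-monoˡ-≤ {α} {α′} (sup J g) p = ∨-least
  (≤-trans p (+ₒ-increasing (sup J g)))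
  (sup≤ λ j → ∨-introʳ {β = α′} (<sup j (+ₒ-monoˡ-≤ (g j) p)))

2^-mono-≤ : ∀ {α β} → α ≤ β → 2^ α ≤ 2^ β
2^-double : ∀ {α β} → α < β → 2^ α +ₒ 2^ α ≤ 2^ β
2^-mono-≤ {sup I f} {β} (sup≤ p) = ∨-least
  (sup≤ λ _ → 2^-positive β)
  (≤-intro λ q → let (i , r) = ⋁-elim {f = λ i → 2^ f i +ₒ 2^ f i} q
                 in <-≤-trans r (2^-double (p i)))
2^-double {α} {sup J g} (<sup j p) = ≤-intro λ q →
  ∨-introʳ {β = suc 𝟘} (⋁-intro {f = λ j → 2^ g j +ₒ 2^ g j} j
    (<-≤-trans q (≤-trans (+ₒ-monoˡ-≤ (2^ α) 2^α≤) (+ₒ-monoʳ-≤ (2^ g j) 2^α≤))))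
  where
  2^α≤ : 2^ α ≤ 2^ g j
  2^α≤ = 2^-mono-≤ p

------------------------------------------------------------------------
-- Sums of hypergames

-- The graph of x + y is built from the root as well as from the graphs of x
-- and y, so that moving inside it agrees with the sum of the moved games only
-- up to bisimilarity.
+-at : ∀ x y m n → (graph (x + y) at-node (m , n)) ∼ (graph x at-node m) + (graph y at-node n)
+-at x y m n = _≡_ ,
  record
    { forth = λ { refl (inj₁ i) → inj₁ i , refl ; refl (inj₂ j) → inj₂ j , refl }
    ; back  = λ { refl (inj₁ i) → inj₁ i , refl ; refl (inj₂ j) → inj₂ j , refl }
    } ,
  refl

+-comm : ∀ x y → x + y ∼ y + x
+-comm x y = (λ (m , n) (n′ , m′) → m ≡ m′ × n ≡ n′) ,
  record
    { forth = λ { (refl , refl) (inj₁ i) → inj₂ i , refl , refl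
                ; (refl , refl) (inj₂ j) → inj₁ j , refl , refl }
    ; back  = λ { (refl , refl) (inj₁ j) → inj₂ j , refl , refl
                ; (refl , refl) (inj₂ i) → inj₁ i , refl , refl }
    } ,
  refl , refl

module WithExcludedMiddle (em : ExcludedMiddle 1ℓ) where

  open Classical em renaming (cong to ⟦⟧-cong)

  ----------------------------------------------------------------------
  -- Binary digits

  Decreasing : List Ord → Set₁
  Decreasing = Linked (flip _<_)

  -- Equality of ordinals as a truth value.
  _≡ᵇ_ : Ord → Ord → Bool
  a ≡ᵇ e = does (em {a ≈ e})

  ≡ᵇ-true : ∀ {a e} → a ≈ e → a ≡ᵇ e ≡ true
  ≡ᵇ-true = dec-true em

  ≡ᵇ-false : ∀ {a e} → ¬ a ≈ e → a ≡ᵇ e ≡ false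
  ≡ᵇ-false = dec-false em

  ≡ᵇ-congˡ : ∀ {a b} e → a ≈ b → a ≡ᵇ e ≡ b ≡ᵇ e
  ≡ᵇ-congˡ {a} {b} e p with em {b ≈ e}
  ... | yes q = ≡ᵇ-true (≈-trans p q)
  ... | no ¬q = ≡ᵇ-false λ q → ¬q (≈-trans (≈-sym p) q)

  -- The digit at place e, as the parity of the number of occurrences of e.
  -- Counted this way, digits are additive under _△_ without any assumption on
  -- the lists.
  digit : List Ord → Ord → Bool
  digit []       e = false
  digit (a ∷ as) e = (a ≡ᵇ e) xor digit as e

  xor-swap : ∀ p q r → p xor (q xor r) ≡ q xor (p xor r)
  xor-swap p q r = trans (sym (xor-assoc p q r))
    (trans (cong (_xor r) (xor-comm p q)) (xor-assoc q p r))

  xor-cancelʳ : ∀ p q → (p xor q) xor q ≡ p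
  xor-cancelʳ p q = trans (xor-assoc p q q)
    (trans (cong (p xor_) (xor-same q)) (xor-identityʳ p))

  xor-cancelˡ : ∀ p q r → (p xor q) xor (p xor r) ≡ q xor r
  xor-cancelˡ p q r = trans (sym (xor-assoc (p xor q) p r))
    (cong (_xor r) (trans (cong (_xor p) (xor-comm p q)) (xor-cancelʳ q p)))

  -- Induction for byCases: used in place of a case distinction on compare a b,
  -- since the recursive calls must see the whole lists a ∷ as and b ∷ bs.
  byCases-elim : ∀ {ℓ} {A B C X : Set₁} {x y z : X} (P : X → Set ℓ) (t : Tri A B C) →
    (A → P x) → (B → P y) → (C → P z) → P (byCases t x y z)
  byCases-elim P (tri< a _ _) f g h = f a
  byCases-elim P (tri≈ _ b _) f g h = g b
  byCases-elim P (tri> _ _ c) f g h = h c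

  digit-△ : ∀ as bs e → digit (as △ bs) e ≡ digit as e xor digit bs e
  digit-△ []       bs       e = refl
  digit-△ (a ∷ as) []       e = sym (xor-identityʳ _)
  digit-△ (a ∷ as) (b ∷ bs) e = byCases-elim (λ cs → digit cs e ≡ digit (a ∷ as) e xor digit (b ∷ bs) e) (compare a b)
    (λ _ → trans (cong ((b ≡ᵇ e) xor_) (digit-△ (a ∷ as) bs e))
      (xor-swap (b ≡ᵇ e) (digit (a ∷ as) e) (digit bs e)))
    (λ a≈b → trans (digit-△ as bs e)
      (trans (sym (xor-cancelˡ (a ≡ᵇ e) (digit as e) (digit bs e)))
        (cong (λ p → digit (a ∷ as) e xor (p xor digit bs e)) (≡ᵇ-congˡ e a≈b))))
    (λ _ → trans (cong ((a ≡ᵇ e) xor_) (digit-△ as (b ∷ bs) e))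
      (sym (xor-assoc (a ≡ᵇ e) (digit as e) (digit (b ∷ bs) e))))

  -- The bound c makes the recursion work: the new head becomes the bound of
  -- the remaining lists.
  △-below : ∀ {c} as bs → Decreasing (c ∷ as) → Decreasing (c ∷ bs) → Decreasing (c ∷ (as △ bs))
  △-below []       bs       p q = q
  △-below (a ∷ as) []       p q = p
  △-below {c} (a ∷ as) (b ∷ bs) (a<c ∷ p) (b<c ∷ q) =
    byCases-elim (λ cs → Decreasing (c ∷ cs)) (compare a b)
      (λ a<b → b<c ∷ △-below (a ∷ as) bs (a<b ∷ p) q)
      (λ (_ , b≤a) → weakenHead (<⇒≤ a<c) (△-below as bs p (weakenHead b≤a q)))
      (λ b<a → a<c ∷ △-below as (b ∷ bs) p (b<a ∷ q))

  bound : ∀ {as} → Decreasing as → Σ[ c ∈ Ord ] Decreasing (c ∷ as)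
  bound {[]}     p = 𝟘 , [-]
  bound {a ∷ as} p = suc a , <sup tt ≤-refl ∷ p

  △-decreasing : ∀ {as bs} → Decreasing as → Decreasing bs → Decreasing (as △ bs)
  △-decreasing {as} {bs} p q with bound p | bound q
  ... | c , p′ | d , q′ with ≤-total c d
  ...   | inj₁ c≤d = Linked.tail (△-below as bs (weakenHead c≤d p′) q′)
  ...   | inj₂ d≤c = Linked.tail (△-below as bs p′ (weakenHead d≤c q′))

  digit-above : ∀ {c as e} → Decreasing (c ∷ as) → c ≤ e → digit as e ≡ false
  digit-above [-]       c≤e = refl
  digit-above (a<c ∷ p) c≤e = cong₂ _xor_
    (≡ᵇ-false λ (_ , e≤a) → ≤⇒≯ (≤-trans c≤e e≤a) a<c)
    (digit-above p (≤-trans (<⇒≤ a<c) c≤e))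

  -- 2^ a + 2^ b + … < 2^ a + 2^ a ≤ 2^ c for c > a > b > ….
  value-below : ∀ {c as} → Decreasing (c ∷ as) → value as < 2^ c
  value-below {c} [-]               = 2^-positive c
  value-below {as = a ∷ _} (a<c ∷ p) =
    <-≤-trans (+ₒ-monoʳ-< (2^ a) (value-below p)) (2^-double a<c)

  infix 4 _≺_

  -- The highest place where p and q differ has digit 0 in p and 1 in q.
  _≺_ : (Ord → Bool) → (Ord → Bool) → Set₁
  p ≺ q = Σ[ e ∈ Ord ] p e ≡ false × q e ≡ true × (∀ {e′} → e < e′ → p e′ ≡ q e′)

  ≺-head : ∀ {b as bs} → Decreasing (b ∷ as) → Decreasing (b ∷ bs) → digit as ≺ digit (b ∷ bs)
  ≺-head {b} p q = b , digit-above p ≤-refl ,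
    cong₂ _xor_ (≡ᵇ-true ≈-refl) (digit-above q ≤-refl) ,
    λ b<e → trans (digit-above p (<⇒≤ b<e))
      (sym (cong₂ _xor_ (≡ᵇ-false λ (_ , e≤b) → ≤⇒≯ e≤b b<e) (digit-above q (<⇒≤ b<e))))

  ≺-tail : ∀ {a b} as bs → a ≈ b → Decreasing (b ∷ bs) →
           digit as ≺ digit bs → digit (a ∷ as) ≺ digit (b ∷ bs)
  ≺-tail {a} {b} as bs a≈b q (e , as-e , bs-e , above) with <⊎≥ e b
  ... | inj₁ e<b = e ,
          cong₂ _xor_ (≡ᵇ-false λ (a≤e , _) → ≤⇒≯ (≤-trans (proj₂ a≈b) a≤e) e<b) as-e ,
          cong₂ _xor_ (≡ᵇ-false λ (b≤e , _) → ≤⇒≯ b≤e e<b) bs-e ,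
          λ {e′} e<e′ → cong₂ _xor_ (≡ᵇ-congˡ e′ a≈b) (above e<e′)
  ... | inj₂ b≤e with trans (sym bs-e) (digit-above q b≤e)
  ...   | ()

  value-cong-< : ∀ {a b} as bs → a ≤ b → value as < value bs → value (a ∷ as) < value (b ∷ bs)
  value-cong-< {b = b} as bs a≤b p =
    ≤-<-trans (+ₒ-monoˡ-≤ (value as) (2^-mono-≤ a≤b)) (+ₒ-monoʳ-< (2^ b) p)

  value-cong-≤ : ∀ {a b} as bs → a ≤ b → value as ≤ value bs → value (a ∷ as) ≤ value (b ∷ bs)
  value-cong-≤ {b = b} as bs a≤b p =
    ≤-trans (+ₒ-monoˡ-≤ (value as) (2^-mono-≤ a≤b)) (+ₒ-monoʳ-≤ (2^ b) p)

  -- Expansions compare as their values do.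
  data Comparison (as bs : List Ord) : Set₁ where
    less    : digit as ≺ digit bs → value as < value bs → Comparison as bs
    equal   : (∀ e → digit as e ≡ digit bs e) → value as ≈ value bs → Comparison as bs
    greater : digit bs ≺ digit as → value bs < value as → Comparison as bs

  less-head : ∀ {b as bs} → Decreasing (b ∷ as) → Decreasing (b ∷ bs) → Comparison as (b ∷ bs)
  less-head {b} {bs = bs} p q = less (≺-head p q) (<-≤-trans (value-below p) (+ₒ-increasing (value bs)))

  greater-head : ∀ {a as bs} → Decreasing (a ∷ as) → Decreasing (a ∷ bs) → Comparison (a ∷ as) bs
  greater-head {a} {as} p q = greater (≺-head q p) (<-≤-trans (value-below q) (+ₒ-increasing (value as)))

  comparison : ∀ {as bs} → Decreasing as → Decreasing bs → Comparison as bs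
  comparison {[]}     {[]}     p q = equal (λ _ → refl) ≈-refl
  comparison {[]}     {b ∷ bs} p q = less-head [-] q
  comparison {a ∷ as} {[]}     p q = greater-head p [-]
  comparison {a ∷ as} {b ∷ bs} p q with compare a b
  ... | tri< a<b _ _ = less-head (a<b ∷ p) q
  ... | tri> _ _ b<a = greater-head p (b<a ∷ q)
  ... | tri≈ _ a≈b _ with comparison (Linked.tail p) (Linked.tail q)
  ...   | less s t    = less (≺-tail as bs a≈b q s) (value-cong-< as bs (proj₁ a≈b) t)
  ...   | equal s t   = equal (λ e → cong₂ _xor_ (≡ᵇ-congˡ e a≈b) (s e))
                          (value-cong-≤ as bs (proj₁ a≈b) (proj₁ t) ,
                           value-cong-≤ bs as (proj₂ a≈b) (proj₂ t))
  ...   | greater s t = greater (≺-tail bs as (≈-sym a≈b) p s) (value-cong-< bs as (proj₂ a≈b) t)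

  ≺-irrefl : ∀ {p q} → (∀ e → p e ≡ q e) → ¬ p ≺ q
  ≺-irrefl p≡q (e , pe , qe , _) with trans (sym pe) (trans (p≡q e) qe)
  ... | ()

  value-injective : ∀ {as bs} → Decreasing as → Decreasing bs →
                    value as ≈ value bs → ∀ e → digit as e ≡ digit bs e
  value-injective p q (as≤bs , bs≤as) with comparison p q
  ... | less    _ t = ⊥-elim (≤⇒≯ bs≤as t)
  ... | equal   s _ = s
  ... | greater _ t = ⊥-elim (≤⇒≯ as≤bs t)

  ≡ᵇ-congʳ : ∀ a {e e′} → e ≈ e′ → a ≡ᵇ e ≡ a ≡ᵇ e′
  ≡ᵇ-congʳ a {e′ = e′} p with em {a ≈ e′}
  ... | yes q = ≡ᵇ-true (≈-trans q (≈-sym p))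
  ... | no ¬q = ≡ᵇ-false λ q → ¬q (≈-trans q p)

  digit-congʳ : ∀ as {e e′} → e ≈ e′ → digit as e ≡ digit as e′
  digit-congʳ []       p = refl
  digit-congʳ (a ∷ as) p = cong₂ _xor_ (≡ᵇ-congʳ a p) (digit-congʳ as p)

  true≢false : ∀ {b} → b ≡ true → ¬ b ≡ false
  true≢false refl ()

  ≺-asym : ∀ as bs → digit as ≺ digit bs → ¬ digit bs ≺ digit as
  ≺-asym as bs (e , as-e , bs-e , above) (e′ , bs-e′ , as-e′ , above′) with compare e e′
  ... | tri< e<e′ _ _ = true≢false as-e′ (trans (above e<e′) bs-e′)
  ... | tri≈ _ e≈e′ _ = true≢false bs-e (trans (digit-congʳ bs e≈e′) bs-e′)
  ... | tri> _ _ e′<e = true≢false bs-e (trans (above′ e′<e) as-e)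

  ----------------------------------------------------------------------
  -- Nim sum

  -- The digits of an ordinal and the Nim sum.  Both are opaque so that
  -- unification recovers their arguments instead of unfolding expansions.

  opaque
    bit : Ord → Ord → Bool
    bit α = digit (exponents (base2 α))

    infixl 6 _⊞_

    _⊞_ : Ord → Ord → Ord
    _⊞_ = _⊕ₒ_

    bit-injective : ∀ {α β} → (∀ e → bit α e ≡ bit β e) → α ≈ β
    bit-injective {α} {β} p with comparison (decreasing (base2 α)) (decreasing (base2 β))
    ... | less    s _ = ⊥-elim (≺-irrefl p s)
    ... | equal   _ t = ≈-trans (≈-sym (correct (base2 α))) (≈-trans t (correct (base2 β)))
    ... | greater s _ = ⊥-elim (≺-irrefl (λ e → sym (p e)) s)

    bit-value : ∀ as → Decreasing as → ∀ e → bit (value as) e ≡ digit as e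
    bit-value as p = value-injective (decreasing (base2 (value as))) p (correct (base2 (value as)))

    bit-cong : ∀ {α β} → α ≈ β → ∀ e → bit α e ≡ bit β e
    bit-cong {α} {β} p = value-injective (decreasing (base2 α)) (decreasing (base2 β))
      (≈-trans (correct (base2 α)) (≈-trans p (≈-sym (correct (base2 β)))))

    <⇒≺ : ∀ {α β} → α < β → bit α ≺ bit β
    <⇒≺ {α} {β} α<β with comparison (decreasing (base2 α)) (decreasing (base2 β))
    ... | less    s _ = s
    ... | equal   _ t = ⊥-elim (≤⇒≯ (≤-trans (proj₂ (correct (base2 β)))
                          (≤-trans (proj₂ t) (proj₁ (correct (base2 α))))) α<β)
    ... | greater _ t = ⊥-elim (≤⇒≯ (≤-trans (proj₂ (correct (base2 β)))
                          (≤-trans (<⇒≤ t) (proj₁ (correct (base2 α))))) α<β)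

    ≺⇒< : ∀ {α β} → bit α ≺ bit β → α < β
    ≺⇒< {α} {β} α≺β with comparison (decreasing (base2 α)) (decreasing (base2 β))
    ... | less    _ t = ≤-<-trans (proj₂ (correct (base2 α))) (<-≤-trans t (proj₁ (correct (base2 β))))
    ... | equal   s _ = ⊥-elim (≺-irrefl s α≺β)
    ... | greater s _ = ⊥-elim (≺-asym (exponents (base2 α)) (exponents (base2 β)) α≺β s)

    bit-⊞ : ∀ α β e → bit (α ⊞ β) e ≡ bit α e xor bit β e
    bit-⊞ α β e = trans
      (bit-value (exponents (base2 α) △ exponents (base2 β))
        (△-decreasing (decreasing (base2 α)) (decreasing (base2 β))) e)
      (digit-△ (exponents (base2 α)) (exponents (base2 β)) e)

  ⊞-cong : ∀ {α α′ β β′} → α ≈ α′ → β ≈ β′ → α ⊞ β ≈ α′ ⊞ β′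
  ⊞-cong {α} {α′} {β} {β′} p q = bit-injective λ e → trans (bit-⊞ α β e)
    (trans (cong₂ _xor_ (bit-cong p e) (bit-cong q e)) (sym (bit-⊞ α′ β′ e)))

  ⊞-comm : ∀ α β → α ⊞ β ≈ β ⊞ α
  ⊞-comm α β = bit-injective λ e → trans (bit-⊞ α β e)
    (trans (xor-comm (bit α e) (bit β e)) (sym (bit-⊞ β α e)))

  ⊞-cancelʳ : ∀ α β → (α ⊞ β) ⊞ β ≈ α
  ⊞-cancelʳ α β = bit-injective λ e → trans (bit-⊞ (α ⊞ β) β e)
    (trans (cong (_xor bit β e) (bit-⊞ α β e)) (xor-cancelʳ (bit α e) (bit β e)))

  ⊞-solveˡ : ∀ {α β δ} → α ⊞ β ≈ δ → α ≈ δ ⊞ β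
  ⊞-solveˡ {α} {β} p = ≈-trans (≈-sym (⊞-cancelʳ α β)) (⊞-cong p ≈-refl)

  ⊞-injectiveˡ : ∀ {α α′ β} → α ⊞ β ≈ α′ ⊞ β → α ≈ α′
  ⊞-injectiveˡ {α} {α′} {β} p = ≈-trans (⊞-solveˡ p) (⊞-cancelʳ α′ β)

  ⊞-injectiveʳ : ∀ {α β β′} → α ⊞ β ≈ α ⊞ β′ → β ≈ β′
  ⊞-injectiveʳ {α} {β} {β′} p =
    ⊞-injectiveˡ (≈-trans (⊞-comm β α) (≈-trans p (⊞-comm α β′)))

  -- If α has digit 1 at the highest place e where δ and α ⊞ β differ, then β
  -- has digit 0 there.  So δ ⊞ β has digit 0 at e, and agrees with α above e.
  lower-summand : ∀ α β {δ} (s : bit δ ≺ bit (α ⊞ β)) → bit α (proj₁ s) ≡ true → δ ⊞ β < α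
  lower-summand α β {δ} (e , δe , sum-e , above) αe = ≺⇒< (e ,
    trans (bit-⊞ δ β e) (cong₂ _xor_ δe βe) , αe ,
    λ {e′} e<e′ → trans (bit-⊞ δ β e′)
      (trans (cong (_xor bit β e′) (trans (above e<e′) (bit-⊞ α β e′)))
        (xor-cancelʳ (bit α e′) (bit β e′))))
    where
    other : ∀ {p q} → p ≡ true → p xor q ≡ true → q ≡ false
    other {q = false} refl _  = refl
    other {q = true}  refl ()
    βe : bit β e ≡ false
    βe = other αe (trans (sym (bit-⊞ α β e)) sum-e)

  -- The defining property of Nim addition: each δ < α ⊞ β is reached by
  -- decreasing one of the summands.
  ⊞-lower : ∀ α β {δ} → δ < α ⊞ β →
    (Σ[ α′ ∈ Ord ] α′ < α × α′ ⊞ β ≈ δ) ⊎ (Σ[ β′ ∈ Ord ] β′ < β × α ⊞ β′ ≈ δ)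
  ⊞-lower α β {δ} δ<α⊕β = helper (<⇒≺ δ<α⊕β)
    where
    helper : bit δ ≺ bit (α ⊞ β) → _
    helper s@(e , δe , sum-e , above) with bit α e in αe | bit β e in βe
    ... | true  | _     = inj₁ (δ ⊞ β , lower-summand α β s αe , ⊞-cancelʳ δ β)
    ... | false | true  = inj₂ (δ ⊞ α , lower-summand β α s′ βe ,
                            ≈-trans (⊞-comm α (δ ⊞ α)) (⊞-cancelʳ δ α))
      where
      s′ : bit δ ≺ bit (β ⊞ α)
      s′ = e , δe , trans (bit-cong (⊞-comm β α) e) sum-e ,
           λ {e′} e<e′ → trans (above e<e′) (bit-cong (⊞-comm α β) e′)
    ... | false | false = ⊥-elim (true≢false sum-e (trans (bit-⊞ α β e) (cong₂ _xor_ αe βe)))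

  ----------------------------------------------------------------------
  -- Games with an ordinal value

  -- One step in the derivation that x has value α, from assertions P about
  -- the values of options and of options of options: every β < α is attained
  -- by an option, and every option has a value below α or a reply of value α.
  -- Options of value above α are covered by the second alternative.  Unlike
  -- the definition of T, this is monotone in P.
  Step : (𝒥 → Ord → Set₁) → 𝒥 → Ord → Set₁
  Step P x α =
    (∀ {β} → β < α → Σ[ i ∈ Opt x ] P (opt x i) β) ×
    (∀ i → (Σ[ β ∈ Ord ] β < α × P (opt x i) β) ⊎ (Σ[ k ∈ Opt (opt x i) ] P (opt (opt x i) k) α))

  Step-map : ∀ {P Q x α} → (∀ {z ε} → P z ε → Q z ε) → Step P x α → Step Q x α
  Step-map h (attain , reply) =
    (λ β<α → let (i , p) = attain β<α in i , h p) ,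
    (λ i → Sum.map (λ (β , β<α , p) → β , β<α , h p) (λ (k , p) → k , h p) (reply i))

  Step-∼ : ∀ {P} → (∀ {x y α} → x ∼ y → P x α → P y α) →
           ∀ {x y α} → x ∼ y → Step P x α → Step P y α
  Step-∼ {P} P-∼ {x} {y} {α} x∼y (attain , reply) =
    (λ β<α → let (i , p) = attain β<α ; (j , q) = ∼-forth x∼y i in j , P-∼ q p) ,
    (λ j → let (i , q) = ∼-forth (∼-sym x∼y) j
           in Sum.map (λ (β , β<α , p) → β , β<α , P-∼ (∼-sym q) p)
                      (λ (k , p) → let (l , r) = ∼-forth (∼-sym q) k in l , P-∼ r p)
                      (reply i))

  mex-unique : ∀ {K α} → (∀ {β} → β < α → β ∈ K) → α ∉ K → α ≈ mex K
  mex-unique {K} {α} below α∉K with <⊎≥ (mex K) α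
  ... | inj₁ μ<α = ⊥-elim (mex-∉ K (below μ<α))
  ... | inj₂ α≤μ = α≤μ , mex-least K α α∉K

  <mex⇒∈ : ∀ {K β} → β < mex K → β ∈ K
  <mex⇒∈ {K} {β} β<μ with em {β ∈ K}
  ... | yes p = p
  ... | no ¬p = ⊥-elim (≤⇒≯ (mex-least K β ¬p) β<μ)

  ⊥₋⊎defined : ∀ m → m ≈₋ ⊥₋ ⊎ Σ[ α ∈ Ord ] m ≈₋ [ α ]
  ⊥₋⊎defined ⊥₋    = inj₁ ⊥₋≈⊥₋
  ⊥₋⊎defined [ α ] = inj₂ (α , [ ≈-refl ])

  ¬⊥₋ : ∀ {m α} → m ≈₋ ⊥₋ → ¬ m ≈₋ [ α ]
  ¬⊥₋ ⊥₋≈⊥₋ ()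

  -- If f y > α for an option y of x, then y has an option of value α, as f y
  -- is the mex of the values of the options of y.
  T-step : ∀ (f : D) x {α} → ⟦ T f ⟧ x ≈₋ [ α ] → Step (λ z ε → ⟦ f ⟧ z ≈₋ [ ε ]) x α
  T-step f x {α} p = attain , λ i → reply i (⊥₋⊎defined (⟦ f ⟧ (opt x i)))
    where
    K : SetOfOrd
    K = 𝓕 ⟦ f ⟧ x
    α≈μ : α ≈ mex K
    α≈μ = proj₁ (T-elim ⟦ f ⟧ x p)
    attain : ∀ {β} → β < α → Σ[ i ∈ Opt x ] ⟦ f ⟧ (opt x i) ≈₋ [ β ]
    attain β<α = ∈𝓕⁻ ⟦ f ⟧ x (<mex⇒∈ (<-≤-trans β<α (proj₁ α≈μ)))
    reply : ∀ i → _ →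
      (Σ[ β ∈ Ord ] β < α × ⟦ f ⟧ (opt x i) ≈₋ [ β ]) ⊎
      (Σ[ k ∈ Opt (opt x i) ] ⟦ f ⟧ (opt (opt x i) k) ≈₋ [ α ])
    reply i (inj₁ q) = let (k , r) = proj₂ (T-elim ⟦ f ⟧ x p) i q in inj₂ (k , ≈₋-respʳ (≈-sym α≈μ) r)
    reply i (inj₂ (β , q)) with compare β α
    ... | tri< β<α _ _ = inj₁ (β , β<α , q)
    ... | tri≈ _ β≈α _ = ⊥-elim (mex-∉ K (∈𝓕⁺ ⟦ f ⟧ x i (≈₋-respʳ (≈-trans β≈α α≈μ) q)))
    ... | tri> _ _ α<β = inj₂ (∈𝓕⁻ ⟦ f ⟧ (opt x i)
            (<mex⇒∈ (<-≤-trans α<β (proj₁ (proj₁ (inD f (opt x i) q))))))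

  infix 4 _⇓_

  -- x ⇓ α: the game x has the ordinal value α.  Opaque, so that x and α can be
  -- inferred.

  opaque
    _⇓_ : 𝒥 → Ord → Set₁
    x ⇓ α = ⟦ γ₀ ⟧ x ≈₋ [ α ]

  Valued : 𝒥 → Set₁
  Valued x = Σ[ α ∈ Ord ] x ⇓ α

  -- The set K in γ x = ∞[ K ].
  𝓚 : 𝒥 → SetOfOrd
  𝓚 x = 𝓕 ⟦ γ₀ ⟧ x

  -- The two shapes of γ x.
  data View (x : 𝒥) : Grundy → Set₁ where
    valued   : ∀ {α} → x ⇓ α → View x (ord α)
    unvalued : ¬ Valued x → View x ∞[ 𝓚 x ]

  opaque
    unfolding _⇓_

    ⇓-≈ : ∀ {x α β} → α ≈ β → x ⇓ α → x ⇓ β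
    ⇓-≈ = ≈₋-respʳ

    ⇓-functional : ∀ {x α β} → x ⇓ α → x ⇓ β → α ≈ β
    ⇓-functional = ≈₋-deterministic

    ∈𝓚⁺ : ∀ x {α} i → opt x i ⇓ α → α ∈ 𝓚 x
    ∈𝓚⁺ x i p = ∈𝓕⁺ ⟦ γ₀ ⟧ x i p

    ∈𝓚⁻ : ∀ x {α} → α ∈ 𝓚 x → Σ[ i ∈ Opt x ] opt x i ⇓ α
    ∈𝓚⁻ x p = ∈𝓕⁻ ⟦ γ₀ ⟧ x p

    ⇓-∼ : ∀ {x y α} → x ∼ y → x ⇓ α → y ⇓ α
    ⇓-∼ x∼y p = ≈₋-trans ≈-trans (⟦⟧-cong γ₀ (∼-sym x∼y)) p

    ⇓-step : ∀ {x α} → x ⇓ α → Step _⇓_ x α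
    ⇓-step {x} p = T-step γ₀ x (≈₋-trans ≈-trans (γ₀-fixpoint x) p)

    ⇓-option-≉ : ∀ {x α β} i → x ⇓ α → opt x i ⇓ β → ¬ α ≈ β
    ⇓-option-≉ {x} i p q α≈β = mex-∉ (𝓕 ⟦ γ₀ ⟧ x)
      (∈𝓕⁺ ⟦ γ₀ ⟧ x i (≈₋-respʳ (≈-trans (≈-sym α≈β) (proj₁ (inD γ₀ x p))) q))

    -- It suffices that the option values differ from α; those above α need no
    -- reply to be exhibited.
    ⇓-intro : ∀ {x α} → (∀ {β} → β < α → Σ[ i ∈ Opt x ] opt x i ⇓ β) →
      (∀ i → (Σ[ β ∈ Ord ] opt x i ⇓ β × ¬ β ≈ α) ⊎ (Σ[ k ∈ Opt (opt x i) ] opt (opt x i) k ⇓ α)) →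
      x ⇓ α
    ⇓-intro {x} {α} attain reply =
      ≈₋-trans ≈-trans (≈₋-sym ≈-sym (γ₀-fixpoint x)) (T-intro ⟦ γ₀ ⟧ x answered α≈μ)
      where
      K : SetOfOrd
      K = 𝓕 ⟦ γ₀ ⟧ x
      α∉K : α ∉ K
      α∉K α∈K with ∈𝓕⁻ ⟦ γ₀ ⟧ x α∈K
      ... | i , p with reply i
      ...   | inj₁ (β , q , β≉α) = β≉α (≈₋-deterministic q p)
      ...   | inj₂ (k , q)       = ⇓-option-≉ k p q ≈-refl
      α≈μ : α ≈ mex K
      α≈μ = mex-unique (λ β<α → let (i , p) = attain β<α in ∈𝓕⁺ ⟦ γ₀ ⟧ x i p) α∉K
      answered : Answered ⟦ γ₀ ⟧ x
      answered i p with reply i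
      ... | inj₁ (β , q , _) = ⊥-elim (¬⊥₋ p q)
      ... | inj₂ (k , q)     = k , ≈₋-respʳ α≈μ q

    options-valued⇒valued : ∀ x → (∀ i → Valued (opt x i)) → Valued x
    options-valued⇒valued x p = mex (𝓕 ⟦ γ₀ ⟧ x) ,
      ≈₋-trans ≈-trans (≈₋-sym ≈-sym (γ₀-fixpoint x))
        (T-intro ⟦ γ₀ ⟧ x (λ i q → ⊥-elim (¬⊥₋ q (proj₂ (p i)))) ≈-refl)

    -- γ₀ assigns a value only at some stage, from values of earlier stages.
    ⇓-induction : (P : 𝒥 → Ord → Set₁) →
      (∀ {x α} → x ⇓ α → Step (λ z ε → z ⇓ ε × P z ε) x α → P x α) →
      ∀ {x α} → x ⇓ α → P x α
    ⇓-induction P step {x} p = let (δ , q) = ⨆-elim iterate iterates-chain x p in below δ q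
      where
      below : ∀ δ {x α} → ⟦ iterate δ ⟧ x ≈₋ [ α ] → P x α
      below α@(sup I f) {x} p =
        let (i , q) = ⨆-elim (λ i → T (iterate (f (lower i))))
                        (λ i j → iterate-chain (f (lower i)) (f (lower j))) x p
            δ = f (lower i)
        in step (⊑₋-elim (γ₀-upper α x) p)
             (Step-map (λ {z} r → ⊑₋-elim (γ₀-upper δ z) r , below δ r) (T-step (iterate δ) x q))

    view : ∀ x → View x (γ x)
    view x = helper (⟦ γ₀ ⟧ x) (≈₋-refl ≈-refl)
      where
      helper : ∀ m → ⟦ γ₀ ⟧ x ≈₋ m → View x (grundy m (𝓚 x))
      helper [ α ] p = valued p
      helper ⊥₋    p = unvalued λ (_ , q) → ¬⊥₋ p q

  ----------------------------------------------------------------------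
  -- Values of sums

  opt-+ˡ : ∀ x y i → opt (x + y) (inj₁ i) ∼ opt x i + y
  opt-+ˡ x y i = +-at x y (target (graph x) (root x) i) (root y)

  opt-+ʳ : ∀ x y j → opt (x + y) (inj₂ j) ∼ x + opt y j
  opt-+ʳ x y j = +-at x y (root x) (target (graph y) (root y) j)

  -- The inductions on x ⇓ α and y ⇓ β are nested: step has the hypothesis for
  -- the options of x and arbitrary y, and for x and the options of y.
  ⇓-+ : ∀ {x y α β} → x ⇓ α → y ⇓ β → x + y ⇓ α ⊞ β
  ⇓-+ {y = y} {β = β} x⇓α = ⇓-induction (λ x α → ∀ y β → y ⇓ β → x + y ⇓ α ⊞ β)
    (λ {x} {α} _ stepˣ y β → ⇓-induction (λ y β → x + y ⇓ α ⊞ β) (step x α stepˣ)) x⇓α y β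
    where
    step : ∀ x α → Step (λ z ε → z ⇓ ε × (∀ y β → y ⇓ β → z + y ⇓ ε ⊞ β)) x α →
           ∀ {y β} → y ⇓ β → Step (λ z ε → z ⇓ ε × (x + z ⇓ α ⊞ ε)) y β → x + y ⇓ α ⊞ β
    step x α (attainˣ , replyˣ) {y} {β} y⇓ (attainʸ , replyʸ) = ⇓-intro attain reply
      where
      attain : ∀ {δ} → δ < α ⊞ β → Σ[ o ∈ Opt (x + y) ] opt (x + y) o ⇓ δ
      attain δ< with ⊞-lower α β δ<
      ... | inj₁ (α′ , α′<α , eq) = let (i , _ , p) = attainˣ α′<α
            in inj₁ i , ⇓-∼ (∼-sym (opt-+ˡ x y i)) (⇓-≈ eq (p y β y⇓))
      ... | inj₂ (β′ , β′<β , eq) = let (j , _ , p) = attainʸ β′<β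
            in inj₂ j , ⇓-∼ (∼-sym (opt-+ʳ x y j)) (⇓-≈ eq p)
      reply : ∀ o → (Σ[ δ ∈ Ord ] opt (x + y) o ⇓ δ × ¬ δ ≈ α ⊞ β) ⊎
                    (Σ[ k ∈ Opt (opt (x + y) o) ] opt (opt (x + y) o) k ⇓ α ⊞ β)
      reply (inj₁ i) with replyˣ i
      ... | inj₁ (α′ , α′<α , _ , p) = inj₁ (α′ ⊞ β , ⇓-∼ (∼-sym (opt-+ˡ x y i)) (p y β y⇓) ,
              λ eq → ≤⇒≯ (proj₂ (⊞-injectiveˡ eq)) α′<α)
      ... | inj₂ (k , _ , p) = inj₂ (inj₁ k ,
              ⇓-∼ (∼-sym (+-at x y (root (opt (opt x i) k)) (root y))) (p y β y⇓))
      reply (inj₂ j) with replyʸ j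
      ... | inj₁ (β′ , β′<β , _ , p) = inj₁ (α ⊞ β′ , ⇓-∼ (∼-sym (opt-+ʳ x y j)) p ,
              λ eq → ≤⇒≯ (proj₂ (⊞-injectiveʳ eq)) β′<β)
      ... | inj₂ (k , _ , p) = inj₂ (inj₂ k ,
              ⇓-∼ (∼-sym (+-at x y (root x) (root (opt (opt y j) k)))) p)

  -- The induction hypothesis for valued-+⁻.  It quantifies over all ways to
  -- see z as a sum, so that it is invariant under bisimilarity and symmetric
  -- in the summands.
  BothValued : 𝒥 → Ord → Set₁
  BothValued z ε = z ⇓ ε × (∀ x y → z ∼ x + y → Valued x × Valued y)

  BothValued-∼ : ∀ {z w ε} → z ∼ w → BothValued z ε → BothValued w ε
  BothValued-∼ z∼w (p , v) = ⇓-∼ z∼w p , λ x y w∼ → v x y (∼-trans z∼w w∼)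

  summandˡ : ∀ {z ε β} x y → z ∼ x + y → BothValued z ε → y ⇓ β → x ⇓ ε ⊞ β
  summandˡ x y z∼ (p , v) y⇓β = let ((_ , q) , _) = v x y z∼
    in ⇓-≈ (⊞-solveˡ (⇓-functional (⇓-+ q y⇓β) (⇓-∼ z∼ p))) q

  -- If x had no value, the value δ ⊞ β could be derived for it after all: every
  -- x + y′ would be without a value, so that each witness moves in x.
  valuedˡ : ∀ x y {δ β} → Step BothValued (x + y) δ → y ⇓ β → Valued x
  valuedˡ x y {δ} {β} (attain⁺ , reply⁺) y⇓β with em {Valued x}
  ... | yes v = v
  ... | no ¬v = δ ⊞ β , ⇓-intro attain reply
    where
    attain : ∀ {α′} → α′ < δ ⊞ β → Σ[ i ∈ Opt x ] opt x i ⇓ α′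
    attain α′< with ⊞-lower δ β α′<
    ... | inj₁ (δ′ , δ′<δ , eq) with attain⁺ δ′<δ
    ...   | inj₁ i , p       = i , ⇓-≈ eq (summandˡ (opt x i) y (opt-+ˡ x y i) p y⇓β)
    ...   | inj₂ j , (_ , v) = ⊥-elim (¬v (proj₁ (v x (opt y j) (opt-+ʳ x y j))))
    -- Some option y′ of y has value β′; the reply to x + y′ is a move x′ in x,
    -- so that x′ + y′ has value δ.
    attain α′< | inj₂ (β′ , β′<β , eq) with proj₁ (⇓-step y⇓β) β′<β
    ... | j , yj⇓β′ with reply⁺ (inj₂ j)
    ...   | inj₁ (_ , _ , (_ , v))  = ⊥-elim (¬v (proj₁ (v x (opt y j) (opt-+ʳ x y j))))
    ...   | inj₂ (inj₁ i , p)       = i , ⇓-≈ eq (summandˡ (opt x i) (opt y j) (+-at x y _ _) p yj⇓β′)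
    ...   | inj₂ (inj₂ k , (_ , v)) = ⊥-elim (¬v (proj₁ (v x (opt (opt y j) k) (+-at x y _ _))))
    reply : ∀ i → (Σ[ ε ∈ Ord ] opt x i ⇓ ε × ¬ ε ≈ δ ⊞ β) ⊎
                  (Σ[ k ∈ Opt (opt x i) ] opt (opt x i) k ⇓ δ ⊞ β)
    reply i with reply⁺ (inj₁ i)
    ... | inj₁ (δ′ , δ′<δ , p) = inj₁ (δ′ ⊞ β , summandˡ (opt x i) y (opt-+ˡ x y i) p y⇓β ,
            λ eq → ≤⇒≯ (proj₂ (⊞-injectiveˡ eq)) δ′<δ)
    ... | inj₂ (inj₁ k , p) = inj₂ (k , summandˡ (opt (opt x i) k) y (+-at x y _ _) p y⇓β)
    -- The reply is a move in y, to a value that differs from β.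
    ... | inj₂ (inj₂ j , p@(_ , v)) = let (_ , (b , yj⇓b)) = v (opt x i) (opt y j) (+-at x y _ _) in
            inj₁ (δ ⊞ b , summandˡ (opt x i) (opt y j) (+-at x y _ _) p yj⇓b ,
              λ eq → ⇓-option-≉ j y⇓β yj⇓b (≈-sym (⊞-injectiveʳ eq)))

  one-valued : ∀ x y {δ} → Step BothValued (x + y) δ → ¬ Valued y → Valued x
  one-valued x y (_ , reply⁺) ¬v = options-valued⇒valued x option-valued
    where
    option-valued : ∀ i → Valued (opt x i)
    option-valued i with reply⁺ (inj₁ i)
    ... | inj₁ (_ , _ , (_ , v))  = ⊥-elim (¬v (proj₂ (v (opt x i) y (opt-+ˡ x y i))))
    ... | inj₂ (inj₁ k , (_ , v)) = ⊥-elim (¬v (proj₂ (v (opt (opt x i) k) y (+-at x y _ _))))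
    ... | inj₂ (inj₂ j , (_ , v)) = proj₁ (v (opt x i) (opt y j) (+-at x y _ _))

  valued-+⁻ : ∀ x y {δ} → x + y ⇓ δ → Valued x × Valued y
  valued-+⁻ x y p = ⇓-induction (λ z _ → ∀ x y → z ∼ x + y → Valued x × Valued y)
    (λ _ s x y z∼ → both x y (Step-∼ BothValued-∼ z∼ s)) p x y ∼-refl
    where
    both : ∀ x y {δ} → Step BothValued (x + y) δ → Valued x × Valued y
    both x y s with em {Valued y}
    ... | yes v@(_ , q) = valuedˡ x y s q , v
    ... | no ¬v         = let v@(_ , q) = one-valued x y s ¬v
                          in v , valuedˡ y x (Step-∼ BothValued-∼ (+-comm x y) s) q

  ----------------------------------------------------------------------
  -- The generalized Grundy function

  𝓚-+ : ∀ x y {β} → ¬ Valued x → y ⇓ β → 𝓚 (x + y) ≋ image (_⊞ β) (𝓚 x)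
  𝓚-+ x y {β} ¬v y⇓β = to , from
    where
    to : 𝓚 (x + y) ⊆ image (_⊞ β) (𝓚 x)
    to δ∈ with ∈𝓚⁻ (x + y) δ∈
    ... | inj₂ j , p = ⊥-elim (¬v (proj₁ (valued-+⁻ x (opt y j) (⇓-∼ (opt-+ʳ x y j) p))))
    ... | inj₁ i , p = let p′ = ⇓-∼ (opt-+ˡ x y i) p
                           ((α , q) , _) = valued-+⁻ (opt x i) y p′
                           (k , α≈) = ∈𝓚⁺ x i q
                       in k , ≈-trans (⇓-functional p′ (⇓-+ q y⇓β)) (⊞-cong α≈ ≈-refl)
    from : image (_⊞ β) (𝓚 x) ⊆ 𝓚 (x + y)
    from (k , δ≈) = let (i , q) = ∈𝓚⁻ x (k , ≈-refl) in
      ∈𝓚⁺ (x + y) (inj₁ i)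
        (⇓-∼ (∼-sym (opt-+ˡ x y i)) (⇓-≈ (≈-sym δ≈) (⇓-+ q y⇓β)))

  𝓚-∼ : ∀ {x y} → x ∼ y → 𝓚 x ⊆ 𝓚 y
  𝓚-∼ {x} {y} x∼y α∈ = let (i , p) = ∈𝓚⁻ x α∈ ; (j , q) = ∼-forth x∼y i
                       in ∈𝓚⁺ y j (⇓-∼ q p)

  𝓚-+-∅ : ∀ x y → ¬ Valued x → ¬ Valued y → 𝓚 (x + y) ≋ ∅
  𝓚-+-∅ x y ¬v ¬w = (λ δ∈ → ⊥-elim (empty δ∈)) , λ ()
    where
    empty : ∀ {δ} → ¬ δ ∈ 𝓚 (x + y)
    empty δ∈ with ∈𝓚⁻ (x + y) δ∈
    ... | inj₁ i , p = ¬w (proj₂ (valued-+⁻ (opt x i) y (⇓-∼ (opt-+ˡ x y i) p)))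
    ... | inj₂ j , p = ¬v (proj₁ (valued-+⁻ x (opt y j) (⇓-∼ (opt-+ʳ x y j) p)))

  opaque
    unfolding _⊞_

    γ-+ : ∀ x y → γ (x + y) ≈ᴳ γ x ⊕ γ y
    γ-+ x y with γ x | view x | γ y | view y | γ (x + y) | view (x + y)
    ... | _ | valued p   | _ | valued q   | _ | valued r   = ord (⇓-functional r (⇓-+ p q))
    ... | _ | valued p   | _ | valued q   | _ | unvalued ¬u = ⊥-elim (¬u (_ , ⇓-+ p q))
    ... | _ | unvalued ¬v | _ | _         | _ | valued r   = ⊥-elim (¬v (proj₁ (valued-+⁻ x y r)))
    ... | _ | valued _   | _ | unvalued ¬w | _ | valued r   = ⊥-elim (¬w (proj₂ (valued-+⁻ x y r)))
    ... | _ | unvalued ¬v | _ | valued q   | _ | unvalued _ = ∞[ 𝓚-+ x y ¬v q ]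
    ... | _ | valued p   | _ | unvalued ¬w | _ | unvalued _ = let (to , from) = 𝓚-+ y x ¬w p in
            ∞[ (λ δ∈ → to (𝓚-∼ (+-comm x y) δ∈)) , (λ δ∈ → 𝓚-∼ (+-comm y x) (from δ∈)) ]
    ... | _ | unvalued ¬v | _ | unvalued ¬w | _ | unvalued _ = ∞[ 𝓚-+-∅ x y ¬v ¬w ]

proposition5p24 : (em : ExcludedMiddle 1ℓ) → let open Classical em in
    ∀ (x y : 𝒥) → γ (x + y) ≈ᴳ γ x ⊕ γ y
proposition5p24 em = WithExcludedMiddle.γ-+ em
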